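{- There is an infinite word $\mathbf{w}$ over the ternary alphabet $\{0,1,2\}$ such that $\mathbf{w}$ is $(9/4)^+$-free and its curling-number transform $C(\mathbf{w})$ is overlap-free.
   Context: Words are indexed from $0$; infinite words are one-sided, $\mathbf{w} = \mathbf{w}[0]\mathbf{w}[1]\cdots$; $x[i..j]$ denotes the factor (contiguous block) $x[i]\cdots x[j]$. A finite word $x$ of length $n \ge 1$ has period $p$, $1\le p\le n$, if $x[i]=x[i+p]$ for all $0\le i<n-p$; its exponent is $n/p$ where $p$ is its least period. A finite or infinite word is $\alpha^+$-free if it has no nonempty finite factor of exponent strictly greater than $\alpha$. An overlap is a word of the form $a x a x a$ with $a$ a single letter and $x$ a possibly empty word; a word is overlap-free if it contains no overlap as a factor (equivalently, it is $2^+$-free). The curling number of a nonempty finite word $u$ is the largest integer $k \ge 1$ such that $u = y z^k$ for some (possibly empty) word $y$ and some nonempty word $z$. For a finite or infinite word $x$, the curling-number transform $C(x)$ is the word over the positive integers, of the same length as $x$, whose $i$-th letter $C(x)[i]$ is the curling number of the prefix $x[0..i]$. -}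

module Defs where

open import Data.Integer.Base using (+_)
open import Data.List.Base
  using (List; []; _∷_; _++_; length; lookup; applyUpTo; replicate; concat; take; drop)
open import Data.List.Properties
  using (≡-dec; length-++; ++-identityʳ)
open import Data.Nat.Base using (ℕ; zero; suc; _+_; _≤_; _<_; z≤n; s≤s)
open import Data.Nat.Properties
  using (≤-trans; ≤-reflexive; m≤m+n; m≤n+m; anyUpTo?; m≤n⇒m<n∨m≡n; ≤-pred)
open import Data.Fin.Base using (toℕ)
open import Data.Product.Base using (∃; ∃-syntax; _×_; _,_; proj₁)
open import Data.Rational.Base using (ℚ; _/_) renaming (_≤_ to _≤ℚ_)
open import Data.Sum.Base using (_⊎_; inj₁; inj₂)
open import Relation.Binary.Definitions using (DecidableEquality)
open import Relation.Binary.PropositionalEquality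
  using (_≡_; _≢_; refl; sym; trans; cong; cong₂; subst)
open import Relation.Nullary.Decidable using (Dec; yes; no; _×-dec_; ¬?; map′)
open import Relation.Nullary.Negation using (¬_; contradiction)

private
  variable
    A : Set

InfWord : Set → Set
InfWord A = ℕ → A

-- The block of length n starting at position i, i.e. w[i..i+n-1].
block : InfWord A → ℕ → ℕ → List A
block w i n = applyUpTo (λ j → w (i + j)) n

_IsFactorOf_ : List A → InfWord A → Set
u IsFactorOf w = ∃[ i ] u ≡ block w i (length u)

HasPeriod : List A → ℕ → Set
HasPeriod u p =
  1 ≤ p × p ≤ length u × (∀ i j → toℕ j ≡ toℕ i + p → lookup u i ≡ lookup u j)

IsLeastPeriod : List A → ℕ → Set
IsLeastPeriod u p = HasPeriod u p × (∀ {q} → HasPeriod u q → p ≤ q)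

-- Periods are positive, so writing the least period as suc q loses nothing.
HasExponent : List A → ℚ → Set
HasExponent u e = ∃[ q ] IsLeastPeriod u (suc q) × e ≡ + length u / suc q

_⁺-Free_ : ℚ → InfWord A → Set
α ⁺-Free w = ∀ u → u ≢ [] → u IsFactorOf w → ∀ e → HasExponent u e → e ≤ℚ α

IsOverlap : List A → Set
IsOverlap u = ∃[ a ] ∃[ x ] u ≡ a ∷ x ++ a ∷ x ++ a ∷ []

OverlapFree : InfWord A → Set
OverlapFree w = ∀ u → u IsFactorOf w → ¬ IsOverlap u

power : List A → ℕ → List A
power z k = concat (replicate k z)

EndsInPower : List A → ℕ → Set
EndsInPower u k = ∃[ y ] ∃[ z ] z ≢ [] × u ≡ y ++ power z k

IsCurlingNumber : List A → ℕ → Set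
IsCurlingNumber u k = 1 ≤ k × EndsInPower u k × (∀ {j} → EndsInPower u j → j ≤ k)

private
  take-length : (y v : List A) → take (length y) (y ++ v) ≡ y
  take-length []      v = refl
  take-length (a ∷ y) v = cong (a ∷_) (take-length y v)

  drop-length : (y v : List A) → drop (length y) (y ++ v) ≡ v
  drop-length []      v = refl
  drop-length (a ∷ y) v = drop-length y v

  ≤-length-power : (z : List A) → z ≢ [] → ∀ k → k ≤ length (power z k)
  ≤-length-power []      z≢[] k       = contradiction refl z≢[]
  ≤-length-power (a ∷ z) z≢[] zero    = z≤n
  ≤-length-power (a ∷ z) z≢[] (suc k) =
    s≤s (≤-trans (≤-length-power (a ∷ z) z≢[] k)
      (≤-trans (m≤n+m _ (length z)) (≤-reflexive (sym (length-++ z)))))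

  endsInPower⇒≤length : (u : List A) → ∀ {k} → EndsInPower u k → k ≤ length u
  endsInPower⇒≤length _ {k} (y , z , z≢[] , refl) =
    ≤-trans (≤-length-power z z≢[] k)
      (≤-trans (m≤n+m _ (length y)) (≤-reflexive (sym (length-++ y))))

  module _ {A : Set} (_≟_ : DecidableEquality A) where

    endsInPower? : (u : List A) (k : ℕ) → Dec (EndsInPower u (suc k))
    endsInPower? u k = map′ to from
      (anyUpTo? (λ i → anyUpTo? (λ m →
        ¬? (≡-dec _≟_ (z i m) []) ×-dec ≡-dec _≟_ u (y i ++ power (z i m) (suc k)))
        (suc (length u))) (suc (length u)))
      where
      y : ℕ → List A
      y i = take i u

      z : ℕ → ℕ → List A
      z i m = take m (drop i u)

      Bounded : Set
      Bounded = ∃[ i ] i < suc (length u) × ∃[ m ] m < suc (length u) ×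
                (z i m ≢ [] × u ≡ y i ++ power (z i m) (suc k))

      to : Bounded → EndsInPower u (suc k)
      to (i , _ , m , _ , p) = y i , z i m , p

      from : EndsInPower u (suc k) → Bounded
      from (y′ , z′ , z′≢[] , refl) =
        length y′ , s≤s (≤-trans (m≤m+n _ _) (≤-reflexive (sym (length-++ y′)))) ,
        length z′ , s≤s (≤-trans (m≤m+n _ _) (≤-trans (≤-reflexive (sym (length-++ z′)))
                      (≤-trans (m≤n+m _ (length y′)) (≤-reflexive (sym (length-++ y′)))))) ,
        subst (_≢ []) (sym z≡) z′≢[] ,
        sym (cong₂ (λ a b → a ++ power b (suc k)) (take-length y′ _) z≡)
        where
        z≡ : z (length y′) (length z′) ≡ z′
        z≡ = trans (cong (take (length z′)) (drop-length y′ _)) (take-length z′ _)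

    search : (u : List A) → EndsInPower u 1 → ∀ b →
             (∀ {j} → EndsInPower u j → j ≤ suc b) → ∃ (IsCurlingNumber u)
    search u p₁ zero    bound = 1 , s≤s z≤n , p₁ , bound
    search u p₁ (suc b) bound with endsInPower? u (suc b)
    ... | yes p = suc (suc b) , s≤s z≤n , p , bound
    ... | no ¬p = search u p₁ b λ {j} q → below q (m≤n⇒m<n∨m≡n (bound q))
      where
      below : ∀ {j} → EndsInPower u j → j < suc (suc b) ⊎ j ≡ suc (suc b) → j ≤ suc b
      below q (inj₁ j<) = ≤-pred j<
      below q (inj₂ refl) = contradiction q ¬p

curlingNumber : DecidableEquality A → (u : List A) → u ≢ [] → ∃ (IsCurlingNumber u)
curlingNumber _≟_ []      u≢[] = contradiction refl u≢[]
curlingNumber _≟_ (a ∷ u) u≢[] =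
  search _≟_ (a ∷ u) ([] , a ∷ u , u≢[] , sym (++-identityʳ _)) (length u)
    (endsInPower⇒≤length (a ∷ u))

curlingTransform : DecidableEquality A → InfWord A → InfWord ℕ
curlingTransform _≟_ w i = proj₁ (curlingNumber _≟_ (block w 0 (suc i)) λ ())

{-# OPTIONS --safe #-}
module Submission where

-- The word w is a shift of W, which concatenates 16-letter blocks determined by four
-- consecutive letters of the Thue–Morse word t.  All squares of W have period at most 4, and a
-- square ends at position n of W exactly when t (n + 32) is true; hence C(w) is a shift of t
-- written with the letters 1 and 2, and t is overlap-free.  Periods below 40 are settled by
-- computation on the factors of W, which are controlled by pairs of consecutive letters of t.
-- A square of period p ≥ 40 would repeat the pattern of short square ends, that is a long
-- factor of t, with period p.  This forces 16 ∣ p, so whole blocks are repeated, and decoding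
-- them yields an overlap in t.

open import Defs
open import Data.Bool.Base using (Bool; true; false; not; _∧_; _∨_; _xor_; T; if_then_else_)
open import Data.Bool.ListAction using (all)
open import Data.Bool.Properties using (T-∧; T-∨; T-≡; not-¬; not-injective; not-involutive)
open import Data.Fin.Base as Fin using (Fin; toℕ)
open import Data.Fin using (#_)
open import Data.Fin.Patterns using (0F; 1F; 2F)
open import Data.Fin.Properties using (_≟_; toℕ<n; toℕ-injective; toℕ-fromℕ<)
open import Data.Integer.Base using (+_)
import Data.Integer.Base as ℤ
import Data.Integer.Properties as ℤ
open import Data.List.Base
  using (List; []; _∷_; _++_; length; lookup; map; zip; take; drop; applyUpTo; upTo)
open import Data.List.Properties
  using (length-applyUpTo; lookup-applyUpTo; length-++; ++-assoc; ++-identityʳ; ∷-injective)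
open import Data.List.Relation.Unary.All.Properties using (all⁺; applyUpTo⁻)
open import Data.Nat.Base hiding (_/_)
open import Data.Nat.DivMod hiding (_/_)
open import Data.Nat.Divisibility using (divides-refl)
open import Data.Nat.Induction using (<-rec)
open import Data.Nat.Properties hiding (_≟_)
open import Data.Nat.Solver using (module +-*-Solver)
open import Data.Product.Base using (Σ-syntax; ∃-syntax; _×_; _,_; proj₁; proj₂)
open import Data.Rational.Base using (_/_)
import Data.Rational.Base as ℚ
import Data.Rational.Properties as ℚ
import Data.Rational.Unnormalised.Base as ℚᵘ
import Data.Rational.Unnormalised.Properties as ℚᵘ
open import Data.Sum.Base using (_⊎_; inj₁; inj₂)
open import Data.Vec.Base as Vec using (Vec; []; _∷_; toList)
open import Function.Base using (_∘_)
open import Function.Bundles using (Equivalence)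
open import Relation.Binary.PropositionalEquality
open import Relation.Nullary.Decidable using (yes; no)
open import Relation.Nullary.Negation using (¬_; contradiction)
open import Algebra.Properties.CommutativeSemigroup +-commutativeSemigroup
  using (x∙yz≈y∙xz; xy∙z≈y∙xz; xy∙z≈xz∙y)

private
  variable
    A B : Set

-- The Thue-Morse word and its recurrences

data HalfView : ℕ → Set where
  even : ∀ k → HalfView (k * 2)
  odd  : ∀ k → HalfView (suc (k * 2))

halfView : ∀ n → HalfView n
halfView zero = even 0
halfView (suc n) with halfView n
... | even k = odd k
... | odd k  = even (suc k)

isOdd : ℕ → Bool
isOdd zero    = false
isOdd (suc n) = not (isOdd n)

-- The first argument only bounds the recursion depth.
thueMorse-below : ℕ → ℕ → Bool
thueMorse-below zero    n = false
thueMorse-below (suc b) n =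
  if isOdd n then not (thueMorse-below b ⌊ n /2⌋) else thueMorse-below b ⌊ n /2⌋

thueMorse-below-zero : ∀ b → thueMorse-below b 0 ≡ false
thueMorse-below-zero zero    = refl
thueMorse-below-zero (suc b) = thueMorse-below-zero b

thueMorse-below-stable : ∀ {b c n} → n ≤ b → n ≤ c → thueMorse-below b n ≡ thueMorse-below c n
thueMorse-below-stable {b} {c} {zero} _ _ =
  trans (thueMorse-below-zero b) (sym (thueMorse-below-zero c))
thueMorse-below-stable {suc b} {suc c} {suc n} n<b n<c =
  cong (λ x → if isOdd (suc n) then not x else x)
    (thueMorse-below-stable (≤-trans half≤ (s≤s⁻¹ n<b)) (≤-trans half≤ (s≤s⁻¹ n<c)))
  where
  half≤ : ⌊ suc n /2⌋ ≤ n
  half≤ = s≤s⁻¹ (⌊n/2⌋<n n)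

isOdd-double : ∀ k → isOdd (k * 2) ≡ false
isOdd-double zero    = refl
isOdd-double (suc k) = trans (not-involutive _) (isOdd-double k)

⌊double/2⌋ : ∀ k → ⌊ k * 2 /2⌋ ≡ k
⌊double/2⌋ zero    = refl
⌊double/2⌋ (suc k) = cong suc (⌊double/2⌋ k)

⌊1+double/2⌋ : ∀ k → ⌊ suc (k * 2) /2⌋ ≡ k
⌊1+double/2⌋ zero    = refl
⌊1+double/2⌋ (suc k) = cong suc (⌊1+double/2⌋ k)

opaque
  t : ℕ → Bool
  t n = thueMorse-below n n

  t-double : ∀ k → t (k * 2) ≡ t k
  t-double zero = refl
  t-double (suc k) rewrite isOdd-double (suc k) | ⌊double/2⌋ k =
    thueMorse-below-stable (s≤s (m≤m*n k 2)) ≤-refl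

  t-1+double : ∀ k → t (suc (k * 2)) ≡ not (t k)
  t-1+double k rewrite isOdd-double k | ⌊1+double/2⌋ k =
    cong not (thueMorse-below-stable (m≤m*n k 2) ≤-refl)

t-pair : ∀ k → t (suc (k * 2)) ≡ not (t (k * 2))
t-pair k = trans (t-1+double k) (cong not (sym (t-double k)))

-- One of the two adjacent pairs among three consecutive positions has the form 2k, 2k + 1, and the
-- letters of such a pair differ.
t-cube-free : ∀ n → t n ≡ t (1 + n) → t (1 + n) ≢ t (2 + n)
t-cube-free n e₀ e₁ with halfView n
... | even k = not-¬ e₀ (trans (sym (not-involutive _)) (cong not (sym (t-pair k))))
... | odd k  = not-¬ e₁ (trans (sym (not-involutive _)) (cong not (sym (t-pair (suc k)))))

-- Repetitions in the Thue-Morse word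

record Agree (f : ℕ → A) (n n′ m : ℕ) : Set where
  constructor agree
  field
    at : ∀ {j} → j < m → f (j + n) ≡ f (j + n′)

open Agree

Agree-sym : ∀ {f : ℕ → A} {n n′ m} → Agree f n n′ m → Agree f n′ n m
Agree-sym a = agree λ j<m → sym (at a j<m)

Agree-≤ : ∀ {f : ℕ → A} {n n′ m m′} → m′ ≤ m → Agree f n n′ m → Agree f n n′ m′
Agree-≤ m′≤m a = agree λ j<m′ → at a (<-≤-trans j<m′ m′≤m)

Agree-tail : ∀ {f : ℕ → A} {n n′ m} → Agree f n n′ (suc m) → Agree f (suc n) (suc n′) m
Agree-tail {f = f} {n} {n′} a = agree λ {j} j<m →
  trans (cong f (+-suc j n)) (trans (at a (s≤s j<m)) (cong f (sym (+-suc j n′))))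

Agree-cons : ∀ {f : ℕ → A} {n n′ m} → f n ≡ f n′ → Agree f (suc n) (suc n′) m →
             Agree f n n′ (suc m)
Agree-cons {f = f} {n} {n′} {m} fn≡ a = agree letter
  where
  letter : ∀ {j} → j < suc m → f (j + n) ≡ f (j + n′)
  letter {zero}  _         = fn≡
  letter {suc j} (s≤s j<m) =
    trans (cong f (sym (+-suc j n))) (trans (at a j<m) (cong f (+-suc j n′)))

double-< : ∀ {j m m′} → m′ * 2 ≤ suc m → j < m′ → j * 2 < m
double-< m′*2≤ j<m′ = s≤s⁻¹ (≤-trans (*-monoˡ-≤ 2 j<m′) m′*2≤)

halve-even : ∀ {k l m m′} → m′ * 2 ≤ suc m → Agree t (k * 2) (l * 2) m → Agree t k l m′
halve-even {k} {l} m′≤ a = agree λ {j} j<m′ → begin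
  t (j + k)            ≡⟨ t-double (j + k) ⟨
  t ((j + k) * 2)      ≡⟨ cong t (*-distribʳ-+ 2 j k) ⟩
  t (j * 2 + k * 2)    ≡⟨ at a (double-< m′≤ j<m′) ⟩
  t (j * 2 + l * 2)    ≡⟨ cong t (*-distribʳ-+ 2 j l) ⟨
  t ((j + l) * 2)      ≡⟨ t-double (j + l) ⟩
  t (j + l)            ∎
  where open ≡-Reasoning

halve-odd : ∀ {k l m m′} → m′ * 2 ≤ suc m →
            Agree t (suc (k * 2)) (suc (l * 2)) m → Agree t k l m′
halve-odd {k} {l} m′≤ a = agree λ {j} j<m′ → not-injective (begin
  not (t (j + k))          ≡⟨ t-1+double (j + k) ⟨
  t (suc ((j + k) * 2))    ≡⟨ cong t (shift j k) ⟩
  t (j * 2 + suc (k * 2))  ≡⟨ at a (double-< m′≤ j<m′) ⟩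
  t (j * 2 + suc (l * 2))  ≡⟨ cong t (shift j l) ⟨
  t (suc ((j + l) * 2))    ≡⟨ t-1+double (j + l) ⟩
  not (t (j + l))          ∎)
  where
  open ≡-Reasoning
  shift : ∀ j x → suc ((j + x) * 2) ≡ j * 2 + suc (x * 2)
  shift j x = trans (cong suc (*-distribʳ-+ 2 j x)) (sym (+-suc (j * 2) (x * 2)))

-- Every second letter, beginning with the first, determines a letter of `t` at half the scale,
-- whatever the parity of `n`. A match of length `m` contains ⌈m/2⌉ such letters, which is the bound
-- on `m′`.
halve-period : ∀ {n m m′} p → m′ * 2 ≤ suc m → Agree t n (p * 2 + n) m →
               ∃[ k ] Agree t k (p + k) m′
halve-period {n} {m} p m′≤ a with halfView n
... | even k = k , halve-even m′≤ (subst (λ x → Agree t (k * 2) x m)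
                     (sym (*-distribʳ-+ 2 p k)) a)
... | odd k  = k , halve-odd m′≤ (subst (λ x → Agree t (suc (k * 2)) x m)
                     (trans (+-suc (p * 2) (k * 2)) (cong suc (sym (*-distribʳ-+ 2 p k)))) a)

-- The constraints t (2i + 1) ≠ t (2i) on both sides force five alternating letters, hence a
-- cube at half the scale.
no-odd-shift : ∀ k l → ¬ Agree t (k * 2) (suc (l * 2)) 5
no-odd-shift k l a = t-cube-free k (t-half k (1 + k) e₀₂) (t-half (1 + k) (2 + k) e₂₄)
  where
  open ≡-Reasoning
  t-half : ∀ i j → t (i * 2) ≡ t (j * 2) → t i ≡ t j
  t-half i j e = trans (sym (t-double i)) (trans e (t-double j))
  e₀₂ : t (k * 2) ≡ t (2 + k * 2)
  e₀₂ = not-injective (begin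
    not (t (k * 2))            ≡⟨ t-pair k ⟨
    t (1 + k * 2)              ≡⟨ at a {1} (s≤s (s≤s z≤n)) ⟩
    t (suc l * 2)              ≡⟨ not-involutive _ ⟨
    not (not (t (suc l * 2)))  ≡⟨ cong not (t-pair (suc l)) ⟨
    not (t (3 + l * 2))        ≡⟨ cong not (at a {2} (s≤s (s≤s (s≤s z≤n)))) ⟨
    not (t (2 + k * 2))        ∎)
  e₂₄ : t (2 + k * 2) ≡ t (4 + k * 2)
  e₂₄ = not-injective (begin
    not (t (suc k * 2))              ≡⟨ t-pair (suc k) ⟨
    t (3 + k * 2)                    ≡⟨ at a {3} (s≤s (s≤s (s≤s (s≤s z≤n)))) ⟩
    t (suc (suc l) * 2)              ≡⟨ not-involutive _ ⟨
    not (not (t (suc (suc l) * 2)))  ≡⟨ cong not (t-pair (suc (suc l))) ⟨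
    not (t (5 + l * 2))              ≡⟨ cong not (at a {4} ≤-refl) ⟨
    not (t (4 + k * 2))              ∎)

-- An odd period joins positions of opposite parity, so `no-odd-shift` applies. If `n` is odd, the
-- even position is the later one, and the match is read backwards.
no-odd-period : ∀ p n → ¬ Agree t n (suc (p * 2) + n) 5
no-odd-period p n a with halfView n
... | even k = no-odd-shift k (p + k)
                 (subst (λ x → Agree t (k * 2) x 5) (cong suc (sym (*-distribʳ-+ 2 p k))) a)
... | odd k  = no-odd-shift (suc (p + k)) k
                 (Agree-sym (subst (λ x → Agree t (suc (k * 2)) x 5)
                   (cong suc (trans (+-suc (p * 2) (k * 2)) (cong suc (sym (*-distribʳ-+ 2 p k))))) a))

-- Halving turns a match of length 1 + 2m into one of length 1 + m. As long as a factor 2 remains to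
-- be extracted, the match has at least five letters, so the current period cannot be odd.
period-divisible : ∀ e {p n} → Agree t n (p + n) (suc (2 ^ suc e)) → ∃[ q ] p ≡ q * 2 ^ e
period-divisible zero {p} a = p , sym (*-identityʳ p)
period-divisible (suc e) {p} {n} a with halfView p
... | odd p′  = contradiction (Agree-≤ (s≤s (*-monoʳ-≤ 2 (*-monoʳ-≤ 2 (m^n>0 2 e)))) a)
                  (no-odd-period p′ n)
... | even p′ =
  let k , a′ = halve-period p′ (≤-reflexive (cong (suc ∘ suc) (*-comm (2 ^ suc e) 2))) a
      q , p′≡ = period-divisible e a′
  in q , trans (cong (_* 2) p′≡) (trans (*-assoc q (2 ^ e) 2) (cong (q *_) (*-comm (2 ^ e) 2)))

-- Descent on the period `suc p`. An even period is halved, and the match still exceeds the halved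
-- period by one. An odd period of at least 5 has a match long enough for `no-odd-period`. Period 1
-- is a cube of a letter. Period 3 has a match of only four letters and is refuted directly from the
-- pairs 2k, 2k + 1.
t-no-overlap : ∀ p n → ¬ Agree t n (suc p + n) (2 + p)
t-no-overlap = <-rec _ step
  where
  step : ∀ p → (∀ {p′} → p′ < p → ∀ n → ¬ Agree t n (suc p′ + n) (2 + p′)) →
         ∀ n → ¬ Agree t n (suc p + n) (2 + p)
  step p rec n a with halfView p
  ... | odd k =
    let l , a′ = halve-period (suc k) ≤-refl a in rec (s≤s (m≤m*n k 2)) l a′
  ... | even zero = t-cube-free n (at a {0} (s≤s z≤n)) (at a {1} (s≤s (s≤s z≤n)))
  ... | even (suc (suc k)) = no-odd-period (suc (suc k)) n (Agree-≤ (m≤m+n 5 _) a)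
  ... | even (suc zero) with halfView n
  ...   | even k = not-¬ refl (begin
    t (2 + k * 2)              ≡⟨ at a {2} (s≤s (s≤s (s≤s z≤n))) ⟩
    t (5 + k * 2)              ≡⟨ t-pair (2 + k) ⟩
    not (t (4 + k * 2))        ≡⟨ cong not (at a {1} (s≤s (s≤s z≤n))) ⟨
    not (t (1 + k * 2))        ≡⟨ cong not (t-pair k) ⟩
    not (not (t (k * 2)))      ≡⟨ not-involutive _ ⟩
    t (k * 2)                  ≡⟨ at a {0} (s≤s z≤n) ⟩
    t (3 + k * 2)              ≡⟨ t-pair (1 + k) ⟩
    not (t (2 + k * 2))        ∎)
    where open ≡-Reasoning
  ...   | odd k  = not-¬ refl (begin
    t (4 + k * 2)              ≡⟨ at a {3} ≤-refl ⟩
    t (7 + k * 2)              ≡⟨ t-pair (3 + k) ⟩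
    not (t (6 + k * 2))        ≡⟨ cong not (at a {2} (s≤s (s≤s (s≤s z≤n)))) ⟨
    not (t (3 + k * 2))        ≡⟨ cong not (t-pair (1 + k)) ⟩
    not (not (t (2 + k * 2)))  ≡⟨ not-involutive _ ⟩
    t (2 + k * 2)              ≡⟨ at a {1} (s≤s (s≤s z≤n)) ⟩
    t (5 + k * 2)              ≡⟨ t-pair (2 + k) ⟩
    not (t (4 + k * 2))        ∎)
    where open ≡-Reasoning

-- Windows of infinite words as lists

window : (ℕ → A) → ℕ → ℕ → List A
window f n zero    = []
window f n (suc m) = f n ∷ window f (suc n) m

applyUpTo≡window : ∀ {f : ℕ → A} {g n} m → (∀ j → g j ≡ f (j + n)) → applyUpTo g m ≡ window f n m
applyUpTo≡window         zero    g≡f = refl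
applyUpTo≡window {f = f} (suc m) g≡f =
  cong₂ _∷_ (g≡f 0) (applyUpTo≡window m λ j → trans (g≡f (suc j)) (cong f (sym (+-suc j _))))

block≡window : ∀ (f : ℕ → A) n m → block f n m ≡ window f n m
block≡window f n m = applyUpTo≡window m λ j → cong f (+-comm n j)

length-window : ∀ (f : ℕ → A) n m → length (window f n m) ≡ m
length-window f n zero    = refl
length-window f n (suc m) = cong suc (length-window f (suc n) m)

window-++ : ∀ (f : ℕ → A) n k m → window f n (k + m) ≡ window f n k ++ window f (k + n) m
window-++ f n zero    m = refl
window-++ f n (suc k) m = cong (f n ∷_)
  (trans (window-++ f (suc n) k m) (cong (λ x → window f (suc n) k ++ window f x m) (+-suc k n)))

take-window : ∀ (f : ℕ → A) n k m → take k (window f n m) ≡ window f n (k ⊓ m)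
take-window f n zero    m       = refl
take-window f n (suc k) zero    = refl
take-window f n (suc k) (suc m) = cong (f n ∷_) (take-window f (suc n) k m)

drop-window : ∀ (f : ℕ → A) n k m → drop k (window f n m) ≡ window f (k + n) (m ∸ k)
drop-window f n zero    m       = refl
drop-window f n (suc k) zero    = refl
drop-window f n (suc k) (suc m) =
  trans (drop-window f (suc n) k m) (cong (λ x → window f x (m ∸ k)) (+-suc k n))

map-window : ∀ (g : A → B) f n m → map g (window f n m) ≡ window (g ∘ f) n m
map-window g f n zero    = refl
map-window g f n (suc m) = cong (g (f n) ∷_) (map-window g f (suc n) m)

zip-window : ∀ (f : ℕ → A) (g : ℕ → B) i j m →
             zip (window f (i + j) m) (window g j m) ≡ window (λ n → f (i + n) , g n) j m
zip-window f g i j zero    = refl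
zip-window f g i j (suc m) = cong ((f (i + j) , g j) ∷_)
  (trans (cong (λ x → zip (window f x m) (window g (suc j) m)) (sym (+-suc i j)))
    (zip-window f g i (suc j) m))

window-toList : ∀ {m} (f : ℕ → A) n (v : Vec A m) →
                (∀ k → f (toℕ k + n) ≡ Vec.lookup v k) → window f n m ≡ toList v
window-toList f n []      f≡v = refl
window-toList f n (x ∷ v) f≡v = cong₂ _∷_ (f≡v 0F)
  (window-toList f (suc n) v λ k → trans (cong f (+-suc (toℕ k) n)) (f≡v (Fin.suc k)))

window-cong : ∀ {f : ℕ → A} {n n′ m} → Agree f n n′ m → window f n m ≡ window f n′ m
window-cong {m = zero}  a = refl
window-cong {m = suc m} a = cong₂ _∷_ (at a (s≤s z≤n)) (window-cong (Agree-tail a))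

window-injective : ∀ {f : ℕ → A} {n n′ m} → window f n m ≡ window f n′ m → Agree f n n′ m
window-injective {m = zero}  eq = agree λ ()
window-injective {m = suc m} eq =
  Agree-cons (proj₁ (∷-injective eq)) (window-injective (proj₂ (∷-injective eq)))

window-++⁻ : ∀ {f : ℕ → A} {n} m xs {ys} → window f n m ≡ xs ++ ys →
             xs ≡ window f n (length xs) × ys ≡ window f (length xs + n) (length ys)
window-++⁻ {f = f} {n} m [] {ys} eq =
  refl , trans (sym eq) (cong (window f n) (trans (sym (length-window f n m)) (cong length eq)))
window-++⁻ {f = f} {n} (suc m) (x ∷ xs) {ys} eq =
  let xs≡ , ys≡ = window-++⁻ m xs (proj₂ (∷-injective eq)) in
  cong₂ _∷_ (sym (proj₁ (∷-injective eq))) xs≡ ,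
  trans ys≡ (cong (λ i → window f i (length ys)) (+-suc (length xs) n))

-- Boolean tests on windows

-- Letters missing from either list count as agreeing.
agrees : ℕ → List (Fin 3) → List (Fin 3) → Bool
agrees zero    _        _        = true
agrees (suc m) []       _        = true
agrees (suc m) (_ ∷ _)  []       = true
agrees (suc m) (x ∷ xs) (y ∷ ys) = (toℕ x ≡ᵇ toℕ y) ∧ agrees m xs ys

agrees⁺ : ∀ {f n n′} m {k l} → Agree f n n′ m → T (agrees m (window f n k) (window f n′ l))
agrees⁺ zero a = _
agrees⁺ (suc m) {zero} a = _
agrees⁺ (suc m) {suc k} {zero} a = _
agrees⁺ (suc m) {suc k} {suc l} a = Equivalence.from T-∧
  (≡⇒≡ᵇ _ _ (cong toℕ (at a (s≤s z≤n))) , agrees⁺ m (Agree-tail a))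

-- Both windows have at least `m` letters, so the default for missing letters is never reached.
agrees⁻ : ∀ {f n n′} m {k l} → T (agrees m (window f n (m + k)) (window f n′ (m + l))) →
          Agree f n n′ m
agrees⁻ zero ok = agree λ ()
agrees⁻ (suc m) ok = let heads , tails = Equivalence.to T-∧ ok in
  Agree-cons (toℕ-injective (≡ᵇ⇒≡ _ _ heads)) (agrees⁻ m tails)

allWindows : ℕ → ℕ → (List A → Bool) → List A → Bool
allWindows zero    l P xs = true
allWindows (suc k) l P xs = P (take l xs) ∧ allWindows k l P (drop 1 xs)

allWindows⁻ : ∀ {f : ℕ → A} {n} k l P {r} → r < k → T (allWindows k l P (window f n (k + l))) →
              T (P (window f (r + n) l))
allWindows⁻ {f = f} {n} (suc k) l P {zero} _ ok =
  subst (T ∘ P) (trans (take-window f n l (suc k + l))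
    (cong (window f n) (m≤n⇒m⊓n≡m (m≤n+m l (suc k))))) (proj₁ (Equivalence.to T-∧ ok))
allWindows⁻ {f = f} {n} (suc k) l P {suc r} (s≤s r<k) ok =
  subst (λ i → T (P (window f i l))) (+-suc r n)
    (allWindows⁻ k l P r<k (proj₂ (Equivalence.to T-∧ ok)))

-- The Thue-Morse morphism on windows

μ : List Bool → List Bool
μ []       = []
μ (x ∷ xs) = x ∷ not x ∷ μ xs

μ^ : ℕ → List Bool → List Bool
μ^ zero    xs = xs
μ^ (suc k) xs = μ^ k (μ xs)

μ-window : ∀ n m → window t (n * 2) (m * 2) ≡ μ (window t n m)
μ-window n zero    = refl
μ-window n (suc m) =
  cong₂ _∷_ (t-double n) (cong₂ _∷_ (t-1+double n) (μ-window (suc n) m))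

μ^-window : ∀ k n m → window t (n * 2 ^ k) (m * 2 ^ k) ≡ μ^ k (window t n m)
μ^-window zero    n m = cong₂ (window t) (*-identityʳ n) (*-identityʳ m)
μ^-window (suc k) n m = begin
  window t (n * 2 ^ suc k) (m * 2 ^ suc k)      ≡⟨ cong₂ (window t) (*-assoc n 2 _) (*-assoc m 2 _) ⟨
  window t (n * 2 * 2 ^ k) (m * 2 * 2 ^ k)      ≡⟨ μ^-window k (n * 2) (m * 2) ⟩
  μ^ k (window t (n * 2) (m * 2))               ≡⟨ cong (μ^ k) (μ-window n m) ⟩
  μ^ (suc k) (window t n m)                     ∎
  where open ≡-Reasoning

-- The 16-letter blocks and the word `W`

-- Found by computer search.  The last three arguments are never all equal in Thue–Morse; those
-- two blocks only serve to make the last three arguments recoverable from the block.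
letters : Bool → Bool → Bool → Bool → Vec (Fin 3) 16
letters _ false false false = Vec.replicate 16 1F
letters _ false false true =
  0F ∷ 2F ∷ 2F ∷ 0F ∷ 0F ∷ 1F ∷ 0F ∷ 0F ∷ 1F ∷ 2F ∷ 0F ∷ 0F ∷ 1F ∷ 2F ∷ 0F ∷ 1F ∷ []
letters false false true false =
  1F ∷ 2F ∷ 0F ∷ 1F ∷ 0F ∷ 1F ∷ 1F ∷ 2F ∷ 1F ∷ 2F ∷ 2F ∷ 1F ∷ 2F ∷ 0F ∷ 2F ∷ 2F ∷ []
letters true false true false =
  2F ∷ 0F ∷ 1F ∷ 2F ∷ 0F ∷ 1F ∷ 1F ∷ 2F ∷ 1F ∷ 2F ∷ 2F ∷ 1F ∷ 2F ∷ 0F ∷ 2F ∷ 2F ∷ []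
letters false false true true =
  1F ∷ 2F ∷ 0F ∷ 1F ∷ 2F ∷ 0F ∷ 0F ∷ 1F ∷ 0F ∷ 1F ∷ 1F ∷ 0F ∷ 0F ∷ 2F ∷ 0F ∷ 0F ∷ []
letters true false true true =
  2F ∷ 0F ∷ 1F ∷ 2F ∷ 0F ∷ 1F ∷ 1F ∷ 2F ∷ 0F ∷ 1F ∷ 1F ∷ 0F ∷ 0F ∷ 2F ∷ 0F ∷ 0F ∷ []
letters _ true false false =
  0F ∷ 2F ∷ 0F ∷ 1F ∷ 1F ∷ 2F ∷ 1F ∷ 1F ∷ 2F ∷ 0F ∷ 1F ∷ 1F ∷ 2F ∷ 0F ∷ 0F ∷ 2F ∷ []
letters _ true false true =
  0F ∷ 2F ∷ 0F ∷ 1F ∷ 1F ∷ 2F ∷ 1F ∷ 1F ∷ 2F ∷ 0F ∷ 1F ∷ 1F ∷ 2F ∷ 0F ∷ 1F ∷ 2F ∷ []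
letters _ true true false =
  2F ∷ 1F ∷ 0F ∷ 0F ∷ 2F ∷ 1F ∷ 1F ∷ 2F ∷ 1F ∷ 2F ∷ 2F ∷ 1F ∷ 2F ∷ 0F ∷ 2F ∷ 2F ∷ []
letters _ true true true = Vec.replicate 16 2F

-- The arguments stand for the letters 0, 2 and 14 of a block; these three already determine the
-- last three arguments of `letters`.
decode : Fin 3 → Fin 3 → Fin 3 → Bool × Bool × Bool
decode 0F 0F 0F = true , false , false
decode 0F 0F _  = true , false , true
decode 0F _  _  = false , false , true
decode 1F 1F _  = false , false , false
decode 2F 2F _  = true , true , true
decode 2F 0F _  = true , true , false
decode _  _  0F = false , true , true
decode _  _  _  = false , true , false

decode-letters : ∀ a b c d → let v = letters a b c d in
                 decode (Vec.lookup v 0F) (Vec.lookup v 2F) (Vec.lookup v (# 14)) ≡ (b , c , d)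
decode-letters _     false false false = refl
decode-letters _     false false true  = refl
decode-letters false false true  false = refl
decode-letters true  false true  false = refl
decode-letters false false true  true  = refl
decode-letters true  false true  true  = refl
decode-letters _     true  false false = refl
decode-letters _     true  false true  = refl
decode-letters _     true  true  false = refl
decode-letters _     true  true  true  = refl

lettersAt : ℕ → Vec (Fin 3) 16
lettersAt i = letters (t i) (t (1 + i)) (t (2 + i)) (t (3 + i))

opaque
  W : InfWord (Fin 3)
  W n = Vec.lookup (lettersAt (n div 16)) (n mod 16)

  W-lookup : ∀ i k → W (toℕ k + i * 16) ≡ Vec.lookup (lettersAt i) k
  W-lookup i k = cong₂ (λ j l → Vec.lookup (lettersAt j) l) quotient≡ remainder≡
    where
    quotient≡ : (toℕ k + i * 16) div 16 ≡ i
    quotient≡ = trans (+-distrib-/-∣ʳ (toℕ k) (divides-refl i))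
      (cong₂ _+_ (m<n⇒m/n≡0 (toℕ<n k)) (m*n/n≡m i 16))
    remainder≡ : (toℕ k + i * 16) mod 16 ≡ k
    remainder≡ = toℕ-injective (trans (toℕ-fromℕ< (m%n<n (toℕ k + i * 16) 16))
      (trans ([m+kn]%n≡m%n (toℕ k) i 16) (m<n⇒m%n≡m (toℕ<n k))))

expand : List Bool → List (Fin 3)
expand (a ∷ xs@(b ∷ c ∷ d ∷ _)) = toList (letters a b c d) ++ expand xs
expand _                        = []

-- A block looks three letters of `t` ahead, so `m` blocks consume `3 + m` letters.
expand-window : ∀ i m → window W (i * 16) (m * 16) ≡ expand (window t i (3 + m))
expand-window i zero    = refl
expand-window i (suc m) = trans (window-++ W (i * 16) 16 (m * 16))
  (cong₂ _++_ (window-toList W (i * 16) (lettersAt i) (W-lookup i)) (expand-window (suc i) m))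

-- Short periods: a finite check on factors of `W`

-- Meant for windows of eight letters, enough for any square of period at most 4; the two offsets
-- are the starts of its two halves.
squareAtEnd : ℕ → List (Fin 3) → Bool
squareAtEnd p xs = agrees p (drop (8 ∸ (p + p)) xs) (drop (8 ∸ p) xs)

endsInShortSquare : List (Fin 3) → Bool
endsInShortSquare xs = squareAtEnd 1 xs ∨ squareAtEnd 2 xs ∨ squareAtEnd 3 xs ∨ squareAtEnd 4 xs

avoids : ℕ → ℕ → List (Fin 3) → Bool
avoids p m xs = not (agrees m xs (drop p xs))

-- For p ≤ 4 the second number is the least m with 4 m > 5 p, the first match of length m at
-- distance p that exceeds exponent 9/4; for 5 ≤ p < 40 even squares are excluded.
avoidsRuns : List (Fin 3) → Bool
avoidsRuns xs = avoids 1 2 xs ∧ avoids 2 3 xs ∧ avoids 3 4 xs ∧ avoids 4 6 xs ∧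
  all (λ p → avoids (5 + p) (5 + p) xs) (upTo 35)

eqHead : List Bool → Bool → Bool
eqHead []      _ = false
eqHead (x ∷ _) y = not (x xor y)

T-not⇒¬T : ∀ {x} → T (not x) → ¬ T x
T-not⇒¬T {false} _ ()

good : List (Bool × Fin 3) → Bool
good xs = eqHead (map proj₁ xs) (endsInShortSquare (take 8 (map proj₂ xs))) ∧
          avoidsRuns (map proj₂ xs)

good⁻ : ∀ xs → T (good xs) →
        T (eqHead (map proj₁ xs) (endsInShortSquare (take 8 (map proj₂ xs)))) ×
        T (avoidsRuns (map proj₂ xs))
good⁻ xs = Equivalence.to T-∧

-- A window of eight letters ends seven letters after its start, whence 39 = 32 + 7.
annotated : ℕ → Bool × Fin 3
annotated n = t (39 + n) , W n

annotatedWindow : ℕ → List Bool → List (Bool × Fin 3)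
annotatedWindow m xs = zip (take m (drop 39 (μ^ 7 xs))) (expand (μ^ 3 xs))

-- One letter of `t` governs 2^7 letters of `t` and 2^3 blocks, that is, 128 letters of `W`; hence
-- 128 starting positions. Two letters give 256 ≥ 39 + 208 letters of `t` and 16 - 3 = 13 blocks, or
-- 208 = 128 + 80 letters of `W`. Windows of 80 letters hold both halves of a square of period 39,
-- the largest tested.
annotatedWindow-good : ∀ xs → length xs ≡ 2 → T (allWindows 128 80 good (annotatedWindow 208 xs))
annotatedWindow-good (false ∷ false ∷ []) refl = _
annotatedWindow-good (false ∷ true  ∷ []) refl = _
annotatedWindow-good (true  ∷ false ∷ []) refl = _
annotatedWindow-good (true  ∷ true  ∷ []) refl = _

-- The lengths are variables because Agda would otherwise unfold the windows.
annotated-window′ : ∀ q {n m m₇ i b m₃} → n ≡ q * 2 ^ 7 → m₇ ≡ 2 * 2 ^ 7 → m ≡ m ⊓ (m₇ ∸ 39) →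
                    n ≡ i * 16 → m ≡ b * 16 → i ≡ q * 2 ^ 3 → m₃ ≡ 2 * 2 ^ 3 → m₃ ≡ 3 + b →
                    window annotated n m ≡ annotatedWindow m (window t q 2)
annotated-window′ q {n} {m} {m₇} {i} {b} {m₃} n≡ m₇≡ m≡ n≡′ m≡′ i≡ m₃≡ m₃≡′ =
  trans (sym (zip-window t W 39 n m)) (cong₂ zip bits≡ letters≡)
  where
  open ≡-Reasoning
  n-window : window t n m₇ ≡ μ^ 7 (window t q 2)
  n-window = trans (cong₂ (window t) n≡ m₇≡) (μ^-window 7 q 2)
  i-window : window t i m₃ ≡ μ^ 3 (window t q 2)
  i-window = trans (cong₂ (window t) i≡ m₃≡) (μ^-window 3 q 2)
  bits≡ : window t (39 + n) m ≡ take m (drop 39 (μ^ 7 (window t q 2)))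
  bits≡ = begin
    window t (39 + n) m                    ≡⟨ cong (window t (39 + n)) m≡ ⟩
    window t (39 + n) (m ⊓ (m₇ ∸ 39))      ≡⟨ take-window t (39 + n) m (m₇ ∸ 39) ⟨
    take m (window t (39 + n) (m₇ ∸ 39))   ≡⟨ cong (take m) (drop-window t n 39 m₇) ⟨
    take m (drop 39 (window t n m₇))       ≡⟨ cong (take m ∘ drop 39) n-window ⟩
    take m (drop 39 (μ^ 7 (window t q 2))) ∎
  letters≡ : window W n m ≡ expand (μ^ 3 (window t q 2))
  letters≡ = begin
    window W n m                    ≡⟨ cong (λ x → window W x m) n≡′ ⟩
    window W (i * 16) m             ≡⟨ cong (window W (i * 16)) m≡′ ⟩
    window W (i * 16) (b * 16)      ≡⟨ expand-window i b ⟩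
    expand (window t i (3 + b))     ≡⟨ cong (expand ∘ window t i) m₃≡′ ⟨
    expand (window t i m₃)          ≡⟨ cong expand i-window ⟩
    expand (μ^ 3 (window t q 2))    ∎

annotated-window : ∀ q → window annotated (q * 128) 208 ≡ annotatedWindow 208 (window t q 2)
annotated-window q =
  annotated-window′ q {q * 128} {208} {256} {q * 8} {13} {16}
    refl refl refl (sym (*-assoc q 8 16)) refl refl refl refl

window-allWindows⁻ : ∀ (f : ℕ → A) n k l m P {n′ r ys} → n′ ≡ r + n → m ≡ k + l → r < k →
                     window f n m ≡ ys → T (allWindows k l P ys) → T (P (window f n′ l))
window-allWindows⁻ f n k l m P refl refl r<k refl ok = allWindows⁻ k l P r<k ok

annotated-good : ∀ n → T (good (window annotated n 80))
annotated-good n = window-allWindows⁻ annotated (n div 128 * 128) 128 80 208 good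
  (m≡m%n+[m/n]*n n 128) refl (m%n<n n 128)
  (annotated-window (n div 128)) (annotatedWindow-good (window t (n div 128) 2) refl)

eqHead⁻ : ∀ x xs y → T (eqHead (x ∷ xs) y) → x ≡ y
eqHead⁻ false _ false _ = refl
eqHead⁻ true  _ true  _ = refl

good-window⁻ : ∀ n m {m′} → m ≡ suc m′ → T (good (window annotated n m)) →
               t (39 + n) ≡ endsInShortSquare (window W n (8 ⊓ m)) × T (avoidsRuns (window W n m))
good-window⁻ n m {m′} refl ok =
  trans (eqHead⁻ (t (39 + n)) (map proj₁ (window annotated (suc n) m′)) _ (proj₁ split))
    (cong endsInShortSquare (trans (cong (take 8) letters≡) (take-window W n 8 m))) ,
  subst (T ∘ avoidsRuns) letters≡ (proj₂ split)
  where
  split = good⁻ (window annotated n m) ok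
  letters≡ : map proj₂ (window annotated n m) ≡ window W n m
  letters≡ = map-window proj₂ annotated n m

t≡endsInShortSquare : ∀ n → t (39 + n) ≡ endsInShortSquare (window W n 8)
t≡endsInShortSquare n = proj₁ (good-window⁻ n 80 refl (annotated-good n))

runs-avoided : ∀ n → T (avoidsRuns (window W n 80))
runs-avoided n = proj₂ (good-window⁻ n 80 refl (annotated-good n))

-- Missing letters count as agreeing, so truncation can only make `avoids` fail; the conclusion
-- therefore holds for every window length `l`.
avoids⁻ : ∀ p m n l → T (avoids p m (window W n l)) → ¬ Agree W n (p + n) m
avoids⁻ p m n l ok a = T-not⇒¬T ok
  (subst (T ∘ agrees m (window W n l)) (sym (drop-window W n p l)) (agrees⁺ m a))

avoidsRuns⁻ : ∀ xs → T (avoidsRuns xs) →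
  T (avoids 1 2 xs) × T (avoids 2 3 xs) × T (avoids 3 4 xs) × T (avoids 4 6 xs) ×
  (∀ {p} → p < 35 → T (avoids (5 + p) (5 + p) xs))
avoidsRuns⁻ xs ok =
  let ok₁ , ok = ∧⁻ ok ; ok₂ , ok = ∧⁻ ok ; ok₃ , ok = ∧⁻ ok ; ok₄ , ok = ∧⁻ ok
  in ok₁ , ok₂ , ok₃ , ok₄ ,
     applyUpTo⁻ (λ p → p) 35 (all⁺ (λ p → avoids (5 + p) (5 + p) xs) (upTo 35) ok)
  where
  ∧⁻ : ∀ {x y} → T (x ∧ y) → T x × T y
  ∧⁻ = Equivalence.to T-∧

runs : ∀ n → let ¬run = λ p m → ¬ Agree W n (p + n) m in
       ¬run 1 2 × ¬run 2 3 × ¬run 3 4 × ¬run 4 6 × (∀ {p} → p < 35 → ¬run (5 + p) (5 + p))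
runs n =
  let ok₁ , ok₂ , ok₃ , ok₄ , ok₅ = avoidsRuns⁻ (window W n 80) (runs-avoided n)
  in avoids⁻ 1 2 n 80 ok₁ , avoids⁻ 2 3 n 80 ok₂ , avoids⁻ 3 4 n 80 ok₃ , avoids⁻ 4 6 n 80 ok₄ ,
     λ {p} p<35 → avoids⁻ (5 + p) (5 + p) n 80 (ok₅ p<35)

-- Long squares of `W`

-- A match of length p ≥ 40 contains p - 7 ≥ 33 matching windows of eight letters, each fixing a
-- letter of `t`. Since 33 = 1 + 2^5, this is just what `period-divisible 4` requires.
long-square-period : ∀ {p} n → 40 ≤ p → Agree W n (p + n) p → ∃[ q ] p ≡ q * 16
long-square-period {p} n 40≤p a = period-divisible 4 {p} {39 + n} t-agree
  where
  open ≡-Reasoning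
  same-window : ∀ {j} → j < 33 → window W (j + n) 8 ≡ window W (j + (p + n)) 8
  same-window {j} j<33 = window-cong {f = W} (agree λ {i} i<8 →
    trans (cong W (sym (+-assoc i j n))) (trans
      (at a (<-≤-trans (+-mono-<-≤ i<8 (s≤s⁻¹ j<33)) 40≤p)) (cong W (+-assoc i j (p + n)))))
  t-agree : Agree t (39 + n) (p + (39 + n)) 33
  t-agree = agree λ {j} j<33 → begin
    t (j + (39 + n))                                ≡⟨ cong t (x∙yz≈y∙xz j 39 n) ⟩
    t (39 + (j + n))                                ≡⟨ t≡endsInShortSquare (j + n) ⟩
    endsInShortSquare (window W (j + n) 8)          ≡⟨ cong endsInShortSquare (same-window j<33) ⟩
    endsInShortSquare (window W (j + (p + n)) 8)    ≡⟨ t≡endsInShortSquare (j + (p + n)) ⟨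
    t (39 + (j + (p + n)))                          ≡⟨ cong t (x∙yz≈y∙xz j 39 (p + n)) ⟨
    t (j + (39 + (p + n)))                          ≡⟨ cong (λ x → t (j + x)) (x∙yz≈y∙xz 39 p n) ⟩
    t (j + (p + (39 + n)))                          ∎

-- Such a square repeats 1 + q full blocks, and these determine 3 + q consecutive letters of t.
no-square-16 : ∀ q n → ¬ Agree W n ((2 + q) * 16 + n) ((2 + q) * 16)
no-square-16 q n a = t-no-overlap (suc q) (suc i) (agree t-overlap)
  where
  -- The block containing `n` is skipped even if it starts at `n`. This costs at most 16 of the (2 +
  -- q) · 16 matching letters and leaves the full blocks i, ..., i + q.
  i = suc (n div 16)
  same-letters : ∀ {j} → j ≤ q → ∀ k →
                 Vec.lookup (lettersAt (j + i)) k ≡ Vec.lookup (lettersAt (2 + q + (j + i))) k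
  same-letters {j} j≤q k = begin
    Vec.lookup (lettersAt (j + i)) k                ≡⟨ W-lookup (j + i) k ⟨
    W (toℕ k + (j + i) * 16)                        ≡⟨ cong W position ⟨
    W (x + n)                                       ≡⟨ at a x<p ⟩
    W (x + ((2 + q) * 16 + n))                      ≡⟨ cong W (x∙yz≈y∙xz x ((2 + q) * 16) n) ⟩
    W ((2 + q) * 16 + (x + n))                      ≡⟨ cong (λ y → W ((2 + q) * 16 + y)) position ⟩
    W ((2 + q) * 16 + (toℕ k + (j + i) * 16))       ≡⟨ cong W (x∙yz≈y∙xz ((2 + q) * 16) (toℕ k) ((j + i) * 16)) ⟩
    W (toℕ k + ((2 + q) * 16 + (j + i) * 16))       ≡⟨ cong (λ y → W (toℕ k + y)) (*-distribʳ-+ 16 (2 + q) (j + i)) ⟨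
    W (toℕ k + (2 + q + (j + i)) * 16)              ≡⟨ W-lookup (2 + q + (j + i)) k ⟩
    Vec.lookup (lettersAt (2 + q + (j + i))) k      ∎
    where
    open ≡-Reasoning
    d = 16 ∸ n % 16
    c = n div 16 * 16
    x = toℕ k + j * 16 + d
    position : x + n ≡ toℕ k + (j + i) * 16
    position = begin
      x + n                                     ≡⟨ cong (λ y → x + y) (m≡m%n+[m/n]*n n 16) ⟩
      toℕ k + j * 16 + d + (n % 16 + c)         ≡⟨ regroup (toℕ k) (j * 16) d (n % 16) c ⟩
      toℕ k + (j * 16 + (d + n % 16 + c))       ≡⟨ cong (λ y → toℕ k + (j * 16 + (y + c))) d+r≡16 ⟩
      toℕ k + (j * 16 + i * 16)                 ≡⟨ cong (λ y → toℕ k + y) (*-distribʳ-+ 16 j i) ⟨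
      toℕ k + (j + i) * 16                      ∎
      where
      d+r≡16 : d + n % 16 ≡ 16
      d+r≡16 = m∸n+n≡m (m%n≤n n 16)
      regroup : ∀ a b d r c → a + b + d + (r + c) ≡ a + (b + (d + r + c))
      regroup a b d r c = trans (+-assoc (a + b) d (r + c)) (trans (+-assoc a b (d + (r + c)))
        (cong (λ y → a + (b + y)) (sym (+-assoc d r c))))
    x<p : x < (2 + q) * 16
    x<p = <-≤-trans (+-mono-<-≤ (+-mono-<-≤ (toℕ<n k) (*-monoˡ-≤ 16 j≤q)) (m∸n≤m 16 (n % 16)))
      (≤-reflexive (+-comm (16 + q * 16) 16))
  same-context : ∀ {j} → j ≤ q → let k = j + i ; l = 2 + q + k in
    (t (1 + k) , t (2 + k) , t (3 + k)) ≡ (t (1 + l) , t (2 + l) , t (3 + l))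
  same-context {j} j≤q = begin
    _ ≡⟨ decode-letters _ _ _ _ ⟨
    _ ≡⟨ cong₂ (λ f x → f x) (cong₂ decode (same-letters j≤q 0F) (same-letters j≤q 2F))
           (same-letters j≤q (# 14)) ⟩
    _ ≡⟨ decode-letters _ _ _ _ ⟩
    _ ∎
    where open ≡-Reasoning
  -- The first decoded letter of each block covers j ≤ q; the second and third decoded letters of
  -- the last block add the two positions that make the match one longer than the period.
  periodic : ∀ {j} → j < 2 + q ⊎ j ≡ 2 + q → t (suc (j + i)) ≡ t (2 + q + suc (j + i))
  periodic {j} (inj₁ (s≤s j≤1+q)) with m≤n⇒m<n∨m≡n j≤1+q
  ... | inj₁ (s≤s j≤q) =
    trans (cong proj₁ (same-context j≤q)) (cong t (x∙yz≈y∙xz 1 (2 + q) (j + i)))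
  ... | inj₂ refl =
    trans (cong (proj₁ ∘ proj₂) (same-context ≤-refl)) (cong t (x∙yz≈y∙xz 2 (2 + q) (q + i)))
  periodic (inj₂ refl) =
    trans (cong (proj₂ ∘ proj₂) (same-context ≤-refl)) (cong t (x∙yz≈y∙xz 3 (2 + q) (q + i)))
  t-overlap : ∀ {j} → j < 3 + q → t (j + suc i) ≡ t (j + (2 + q + suc i))
  t-overlap {j} j<3+q = trans (cong t (+-suc j i)) (trans (periodic (m≤n⇒m<n∨m≡n (s≤s⁻¹ j<3+q)))
    (cong t (trans (cong (λ x → 2 + q + x) (sym (+-suc j i))) (x∙yz≈y∙xz (2 + q) j (suc i)))))

no-square-multiple : ∀ q n {p} → p ≡ q * 16 → 32 ≤ p → ¬ Agree W n (p + n) p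
no-square-multiple zero          n refl ()
no-square-multiple (suc zero)    n p≡16 32≤p _ =
  n≮n 16 (≤-trans (m≤n+m 17 15) (subst (32 ≤_) p≡16 32≤p))
no-square-multiple (suc (suc q)) n refl _    a = no-square-16 q n a

no-long-square : ∀ {p} n → 40 ≤ p → ¬ Agree W n (p + n) p
no-long-square n 40≤p a =
  let q , p≡ = long-square-period n 40≤p a in
  no-square-multiple q n p≡ (≤-trans (m≤m+n 32 8) 40≤p) a

no-square : ∀ {p} n → 5 ≤ p → ¬ Agree W n (p + n) p
no-square {p} n 5≤p a with p <? 40
... | no p≮40  = no-long-square n (≮⇒≥ p≮40) a
... | yes p<40 with m≤n⇒∃[o]m+o≡n 5≤p
...   | r , refl = proj₂ (proj₂ (proj₂ (proj₂ (runs n)))) (+-cancelˡ-< 5 r 35 p<40) a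

-- The exponent bound 9/4 for `W` and its shift `w`

-- The match spans a factor of length m + p with period p, and the inequality says (m + p)/p ≤ 9/4.
-- From p = 5 on, the absence of squares gives even m < p.
run-bound : ∀ {n m} p → 1 ≤ p → Agree W n (p + n) m → 4 * m ≤ 5 * p
run-bound {n} {m} = λ where
    1 _ → bound 1 1 (proj₁ (runs n)) (m≤m+n 4 1)
    2 _ → bound 2 2 (proj₁ (proj₂ (runs n))) (m≤m+n 8 2)
    3 _ → bound 3 3 (proj₁ (proj₂ (proj₂ (runs n)))) (m≤m+n 12 3)
    4 _ → bound 4 5 (proj₁ (proj₂ (proj₂ (proj₂ (runs n))))) ≤-refl
    (suc p@(suc (suc (suc (suc _))))) _ → bound (suc p) p
      (no-square n (s≤s (s≤s (s≤s (s≤s (s≤s z≤n)))))) (*-mono-≤ (n≤1+n 4) (n≤1+n p))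
  where
  bound : ∀ p k → ¬ Agree W n (p + n) (suc k) → 4 * k ≤ 5 * p →
          Agree W n (p + n) m → 4 * m ≤ 5 * p
  bound p k ¬a 4k≤5p a with m ≤? k
  ... | yes m≤k = ≤-trans (*-monoʳ-≤ 4 m≤k) 4k≤5p
  ... | no m≰k  = contradiction (Agree-≤ (≰⇒> m≰k) a) ¬a

-- The shift 67 is such that, wherever a square of W ends inside w, some such square also starts
-- inside w.
w : InfWord (Fin 3)
w n = W (n + 67)

block-w : ∀ i n → block w i n ≡ window W (i + 67) n
block-w i n = applyUpTo≡window n λ j → cong W (xy∙z≈y∙xz i j 67)

HasPeriod⇒Agree : ∀ i n p → HasPeriod (block w i n) p →
                  p ≤ n × Agree W (i + 67) (p + (i + 67)) (n ∸ p)
HasPeriod⇒Agree i n p (_ , p≤length , periodic) = p≤n , agree λ {j} j<n∸p →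
  let j+p<n = subst (j + p <_) (m∸n+n≡m p≤n) (+-monoˡ-< p j<n∸p)
      j<n   = ≤-<-trans (m≤m+n j p) j+p<n
  in begin
    W (j + (i + 67))                   ≡⟨ cong W (xy∙z≈y∙xz i j 67) ⟨
    w (i + j)                          ≡⟨ letter j<n ⟨
    lookup (block w i n) (index j<n)   ≡⟨ periodic _ _ (trans (toℕ-index j+p<n)
                                              (cong (_+ p) (sym (toℕ-index j<n)))) ⟩
    lookup (block w i n) (index j+p<n) ≡⟨ letter j+p<n ⟩
    w (i + (j + p))                    ≡⟨ cong W (arith i j p 67) ⟩
    W (j + (p + (i + 67)))             ∎
  where
  open ≡-Reasoning
  length≡ : length (block w i n) ≡ n
  length≡ = length-applyUpTo (λ j → w (i + j)) n
  p≤n : p ≤ n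
  p≤n = subst (p ≤_) length≡ p≤length
  index : ∀ {j} → j < n → Fin (length (block w i n))
  index {j} j<n = Fin.fromℕ< (subst (j <_) (sym length≡) j<n)
  toℕ-index : ∀ {j} (j<n : j < n) → toℕ (index j<n) ≡ j
  toℕ-index j<n = toℕ-fromℕ< _
  letter : ∀ {j} (j<n : j < n) → lookup (block w i n) (index j<n) ≡ w (i + j)
  letter j<n = trans (lookup-applyUpTo (λ j → w (i + j)) n (index j<n))
    (cong (λ j → w (i + j)) (toℕ-index j<n))
  arith : ∀ i j p c → i + (j + p) + c ≡ j + (p + (i + c))
  arith = solve 4 (λ i j p c → i :+ (j :+ p) :+ c := j :+ (p :+ (i :+ c))) refl
    where open +-*-Solver

/-≤ : ∀ m n p q → m * suc q ≤ n * suc p → + m / suc p ℚ.≤ + n / suc q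
/-≤ m n p q mq≤np = ℚ.toℚᵘ-cancel-≤ (ℚᵘ.≤-respˡ-≃ (ℚᵘ.≃-sym (ℚ.toℚᵘ-fromℚᵘ (ℚᵘ.mkℚᵘ (+ m) p)))
  (ℚᵘ.≤-respʳ-≃ (ℚᵘ.≃-sym (ℚ.toℚᵘ-fromℚᵘ (ℚᵘ.mkℚᵘ (+ n) q)))
    (ℚᵘ.*≤* (subst₂ ℤ._≤_ (ℤ.pos-* m (suc q)) (ℤ.pos-* n (suc p)) (ℤ.+≤+ mq≤np)))))

period-bound : ∀ i n p → HasPeriod (block w i n) p → n * 4 ≤ 9 * p
period-bound i n p period@(1≤p , _) = let p≤n , a = HasPeriod⇒Agree i n p period in begin
  n * 4                 ≡⟨ cong (_* 4) (m∸n+n≡m p≤n) ⟨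
  (n ∸ p + p) * 4       ≡⟨ *-comm (n ∸ p + p) 4 ⟩
  4 * (n ∸ p + p)       ≡⟨ *-distribˡ-+ 4 (n ∸ p) p ⟩
  4 * (n ∸ p) + 4 * p   ≤⟨ +-monoˡ-≤ (4 * p) (run-bound p 1≤p a) ⟩
  5 * p + 4 * p         ≡⟨ *-distribʳ-+ p 5 4 ⟨
  9 * p                 ∎
  where open ≤-Reasoning

w-⁺-free : (+ 9 / 4) ⁺-Free w
w-⁺-free u _ (i , u≡) e (q , (period , _) , refl) =
  /-≤ (length u) 9 q 3
    (period-bound i (length u) (suc q) (subst (λ v → HasPeriod v (suc q)) u≡ period))

-- Powers at the end of a prefix and curling numbers

power-agree : ∀ k {N} y z → window W 67 N ≡ y ++ power z (2 + k) →
              let p = length z ; m = length y + 67 in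
              Agree W m (p + m) p × (1 ≤ k → Agree W m (p + m) (p + p)) ×
              (k ≡ 0 → length y + (p + p) ≡ N)
power-agree k {N} y z eq = window-injective (trans (sym z₁) z₂) , cube k refl , whole
  where
  p = length z
  m = length y + 67
  yz = window-++⁻ N y eq
  zz = window-++⁻ (length (power z (2 + k))) z (sym (proj₂ yz))
  z₁ = proj₁ zz
  zzz = window-++⁻ (length (power z (1 + k))) z (sym (proj₂ zz))
  z₂ = proj₁ zzz
  cube : ∀ l → k ≡ l → 1 ≤ l → Agree W m (p + m) (p + p)
  cube (suc l) refl _ = window-injective (begin
    window W m (p + p)                            ≡⟨ window-++ W m p p ⟩
    window W m p ++ window W (p + m) p            ≡⟨ cong₂ _++_ (trans (sym z₁) z₂) (trans (sym z₂) z₃) ⟩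
    window W (p + m) p ++ window W (p + (p + m)) p ≡⟨ window-++ W (p + m) p p ⟨
    window W (p + m) (p + p)                      ∎)
    where
    open ≡-Reasoning
    z₃ = proj₁ (window-++⁻ (length (power z (1 + l))) z (sym (proj₂ zzz)))
  whole : k ≡ 0 → length y + (p + p) ≡ N
  whole refl = begin
    length y + (p + p)                ≡⟨ cong (λ l → length y + (p + l)) (cong length (++-identityʳ z)) ⟨
    length y + (p + length (z ++ [])) ≡⟨ cong (λ l → length y + l) (length-++ z) ⟨
    length y + length (power z 2)     ≡⟨ length-++ y ⟨
    length (y ++ power z 2)           ≡⟨ cong length eq ⟨
    length (window W 67 N)            ≡⟨ length-window W 67 N ⟩
    N                                 ∎
    where open ≡-Reasoning

length>0 : ∀ {z : List A} → z ≢ [] → 1 ≤ length z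
length>0 {z = []}    z≢[] = contradiction refl z≢[]
length>0 {z = _ ∷ _} _    = s≤s z≤n

-- The first three copies of a root of length p form a match of length 2p at distance p, for which
-- `run-bound` would give 8p ≤ 5p.
no-cube : ∀ {N k} → 3 ≤ k → ¬ EndsInPower (window W 67 N) k
no-cube {k = suc (suc (suc k))} (s≤s (s≤s (s≤s _))) (y , z , z≢[] , eq) =
  <⇒≱ (*-monoˡ-< (length z) {{>-nonZero (length>0 z≢[])}} (m≤m+n 6 2)) (begin
    8 * length z                ≡⟨ *-distribʳ-+ (length z) 4 4 ⟩
    4 * length z + 4 * length z ≡⟨ *-distribˡ-+ 4 (length z) (length z) ⟨
    4 * (length z + length z)   ≤⟨ run-bound (length z) (length>0 z≢[])
                                     (proj₁ (proj₂ (power-agree (suc k) y z eq)) (s≤s z≤n)) ⟩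
    5 * length z                ∎)
  where open ≤-Reasoning

second-half : ∀ p x → p + p ≤ 8 → p + (8 ∸ (p + p) + x) ≡ 8 ∸ p + x
second-half p x 2p≤8 = begin
  p + (8 ∸ (p + p) + x)  ≡⟨ +-assoc p (8 ∸ (p + p)) x ⟨
  p + (8 ∸ (p + p)) + x  ≡⟨ cong (λ y → p + y + x) (∸-+-assoc 8 p p) ⟨
  p + (8 ∸ p ∸ p) + x    ≡⟨ cong (λ y → y + x) (m+[n∸m]≡n (m+n≤o⇒m≤o∸n p 2p≤8)) ⟩
  8 ∸ p + x              ∎
  where open ≡-Reasoning

squareAtEnd⁺ : ∀ p x → p + p ≤ 8 → let s = 8 ∸ (p + p) + x in
               Agree W s (p + s) p → T (squareAtEnd p (window W x 8))
squareAtEnd⁺ p x 2p≤8 a = subst₂ (λ xs ys → T (agrees p xs ys))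
  (sym (drop-window W x (8 ∸ (p + p)) 8)) (sym (drop-window W x (8 ∸ p) 8))
  (agrees⁺ p (subst (λ s → Agree W (8 ∸ (p + p) + x) s p) (second-half p x 2p≤8) a))

squareAtEnd⁻ : ∀ p x → p + p ≤ 8 → let s = 8 ∸ (p + p) + x in
               T (squareAtEnd p (window W x 8)) → Agree W s (p + s) p
squareAtEnd⁻ p x 2p≤8 ok = subst (λ s → Agree W (8 ∸ (p + p) + x) s p) (sym (second-half p x 2p≤8))
  -- The suffix from the first half on has length p + p, the suffix from the second half on has
  -- length p + 0.
  (agrees⁻ p {p} {0} (subst₂ (λ xs ys → T (agrees p xs ys))
    (trans (drop-window W x (8 ∸ (p + p)) 8) (cong (window W _) (m∸[m∸n]≡n 2p≤8)))
    (trans (drop-window W x (8 ∸ p) 8)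
      (cong (window W _) (trans (m∸[m∸n]≡n (≤-trans (m≤m+n p p) 2p≤8)) (sym (+-identityʳ p))))) ok))

endsInShortSquare⁺ : ∀ p xs → 1 ≤ p → p ≤ 4 → T (squareAtEnd p xs) → T (endsInShortSquare xs)
endsInShortSquare⁺ 1 xs _ _ ok = Equivalence.from (T-∨ {squareAtEnd 1 xs}) (inj₁ ok)
endsInShortSquare⁺ 2 xs _ _ ok = Equivalence.from (T-∨ {squareAtEnd 1 xs}) (inj₂
  (Equivalence.from (T-∨ {squareAtEnd 2 xs}) (inj₁ ok)))
endsInShortSquare⁺ 3 xs _ _ ok = Equivalence.from (T-∨ {squareAtEnd 1 xs}) (inj₂
  (Equivalence.from (T-∨ {squareAtEnd 2 xs}) (inj₂ (Equivalence.from (T-∨ {squareAtEnd 3 xs}) (inj₁ ok)))))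
endsInShortSquare⁺ 4 xs _ _ ok = Equivalence.from (T-∨ {squareAtEnd 1 xs}) (inj₂
  (Equivalence.from (T-∨ {squareAtEnd 2 xs}) (inj₂ (Equivalence.from (T-∨ {squareAtEnd 3 xs}) (inj₂ ok)))))
endsInShortSquare⁺ (suc (suc (suc (suc (suc _))))) _ _ (s≤s (s≤s (s≤s (s≤s ())))) _

endsInShortSquare⁻ : ∀ xs → T (endsInShortSquare xs) →
                     ∃[ p ] 1 ≤ p × p + p ≤ 8 × T (squareAtEnd p xs)
endsInShortSquare⁻ xs ok with Equivalence.to (T-∨ {squareAtEnd 1 xs}) ok
... | inj₁ ok₁ = 1 , s≤s z≤n , m≤m+n 2 6 , ok₁
... | inj₂ ok with Equivalence.to (T-∨ {squareAtEnd 2 xs}) ok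
...   | inj₁ ok₂ = 2 , s≤s z≤n , m≤m+n 4 4 , ok₂
...   | inj₂ ok with Equivalence.to (T-∨ {squareAtEnd 3 xs}) ok
...     | inj₁ ok₃ = 3 , s≤s z≤n , m≤m+n 6 2 , ok₃
...     | inj₂ ok₄ = 4 , s≤s z≤n , ≤-refl , ok₄

-- The start `m` and the last position `n` are counted in `w`, so the square must lie inside `w`;
-- adding 67 converts to positions of `W`.
SquareEndingAt : ℕ → Set
SquareEndingAt n = ∃[ p ] ∃[ m ] 1 ≤ p × m + (p + p) ≡ suc n × Agree W (m + 67) (p + (m + 67)) p

-- By `no-square` the period is at most 4, so the square lies in the eight-letter window of `W` that
-- ends at position 67 + n. That window starts at 60 + n, and 99 = 39 + 60.
square⇒t : ∀ n → SquareEndingAt n → t (99 + n) ≡ true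
square⇒t n (p , m , 1≤p , end , a) with p ≤? 4
... | no p≰4  = contradiction a (no-square (m + 67) (≰⇒> p≰4))
... | yes p≤4 = trans (t≡endsInShortSquare (60 + n)) (Equivalence.to T-≡
  (endsInShortSquare⁺ p _ 1≤p p≤4
    (squareAtEnd⁺ p (60 + n) 2p≤8 (subst (λ s → Agree W s (p + s) p) start a))))
  where
  2p≤8 : p + p ≤ 8
  2p≤8 = +-mono-≤ p≤4 p≤4
  start : m + 67 ≡ 8 ∸ (p + p) + (60 + n)
  start = +-cancelʳ-≡ (p + p) _ _ (begin
    m + 67 + (p + p)                      ≡⟨ xy∙z≈xz∙y m 67 (p + p) ⟩
    m + (p + p) + 67                      ≡⟨ cong (λ x → x + 67) end ⟩
    suc n + 67                            ≡⟨ +-comm (suc n) 67 ⟩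
    67 + suc n                            ≡⟨ +-suc 67 n ⟩
    8 + (60 + n)                          ≡⟨ cong (λ x → x + (60 + n)) (m∸n+n≡m 2p≤8) ⟨
    8 ∸ (p + p) + (p + p) + (60 + n)      ≡⟨ xy∙z≈xz∙y (8 ∸ (p + p)) (p + p) (60 + n) ⟩
    8 ∸ (p + p) + (60 + n) + (p + p)      ∎)
    where open ≡-Reasoning

opaque
  unfolding t W

  -- Here the eight-letter window begins before `w` does, so a square inside `w` has to be exhibited
  -- by evaluation. Only n = 1, 4, 5 need one: for n = 0, 2, 3, 6 the hypothesis computes to
  -- `false ≡ true`.
  t⇒square-start : ∀ n → n < 7 → t (99 + n) ≡ true → SquareEndingAt n
  t⇒square-start 1 _ _ = 1 , 0 , s≤s z≤n , refl , agrees⁻ 1 {0} {0} _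
  t⇒square-start 4 _ _ = 1 , 3 , s≤s z≤n , refl , agrees⁻ 1 {0} {0} _
  t⇒square-start 5 _ _ = 3 , 0 , s≤s z≤n , refl , agrees⁻ 3 {0} {0} _
  t⇒square-start (suc (suc (suc (suc (suc (suc (suc _)))))))
    (s≤s (s≤s (s≤s (s≤s (s≤s (s≤s (s≤s ()))))))) _

t⇒square : ∀ n → t (99 + n) ≡ true → SquareEndingAt n
t⇒square n tn with n <? 7
... | yes n<7 = t⇒square-start n n<7 tn
... | no n≮7 with m≤n⇒∃[o]m+o≡n (≮⇒≥ n≮7)
-- With n = 7 + k the window starts at position 67 + k of `W`, which is letter `k` of `w`, so any
-- square in it lies inside `w`.
...   | k , refl =
  let p , 1≤p , 2p≤8 , ok = endsInShortSquare⁻ (window W (67 + k) 8)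
                              (Equivalence.from T-≡ (trans (sym (t≡endsInShortSquare (67 + k))) tn))
      start = trans (cong (λ x → 8 ∸ (p + p) + x) (+-comm 67 k)) (sym (+-assoc (8 ∸ (p + p)) k 67))
  in p , 8 ∸ (p + p) + k , 1≤p ,
     trans (xy∙z≈xz∙y (8 ∸ (p + p)) k (p + p)) (cong (λ x → x + k) (m∸n+n≡m 2p≤8)) ,
     subst (λ s → Agree W s (p + s) p) start (squareAtEnd⁻ p (67 + k) 2p≤8 ok)

square⇒EndsInPower : ∀ n → SquareEndingAt n → EndsInPower (window W 67 (suc n)) 2
square⇒EndsInPower n (suc p , m , _ , end , a) = window W 67 m , z , (λ ()) , (begin
  window W 67 (suc n)                                ≡⟨ cong (window W 67) end ⟨
  window W 67 (m + (suc p + suc p))                  ≡⟨ window-++ W 67 m (suc p + suc p) ⟩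
  y ++ window W (m + 67) (suc p + suc p)             ≡⟨ cong (y ++_) (window-++ W (m + 67) (suc p) (suc p)) ⟩
  y ++ (z ++ window W (suc p + (m + 67)) (suc p))    ≡⟨ cong (λ z′ → y ++ (z ++ z′)) (window-cong a) ⟨
  y ++ (z ++ z)                                      ≡⟨ cong (λ z′ → y ++ (z ++ z′)) (++-identityʳ z) ⟨
  y ++ power z 2                                     ∎)
  where
  open ≡-Reasoning
  y = window W 67 m
  z = window W (m + 67) (suc p)

EndsInPower⇒square : ∀ n → EndsInPower (window W 67 (suc n)) 2 → SquareEndingAt n
EndsInPower⇒square n (y , z , z≢[] , eq) =
  length z , length y , length>0 z≢[] , proj₂ (proj₂ agree₀) refl , proj₁ agree₀
  where agree₀ = power-agree 0 y z eq

bit : Bool → ℕ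
bit x = if x then 2 else 1

bit-injective : ∀ {x y} → bit x ≡ bit y → x ≡ y
bit-injective {false} {false} _ = refl
bit-injective {true}  {true}  _ = refl

-- With cubes excluded, the curling number is 2 exactly when the prefix ends in a square, and 1
-- otherwise.
curling≡bit : ∀ n k → IsCurlingNumber (window W 67 (suc n)) k → k ≡ bit (t (99 + n))
curling≡bit n 0 (() , _)
curling≡bit n 1 (_ , _ , max) with t (99 + n) in tn
... | false = refl
... | true  = contradiction (max (square⇒EndsInPower n (t⇒square n tn))) (n≮n 1)
curling≡bit n 2 (_ , ends , _) = sym (cong bit (square⇒t n (EndsInPower⇒square n ends)))
curling≡bit n (suc (suc (suc k))) (_ , ends , _) =
  contradiction ends (no-cube {suc n} {3 + k} (s≤s (s≤s (s≤s z≤n))))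

curlingTransform≡bit : ∀ n → curlingTransform _≟_ w n ≡ bit (t (99 + n))
curlingTransform≡bit n = curling≡bit n (curlingTransform _≟_ w n)
  (subst (λ u → IsCurlingNumber u (curlingTransform _≟_ w n)) (block-w 0 (suc n))
    (proj₂ (curlingNumber _≟_ (block w 0 (suc n)) λ ())))

-- Overlap-freeness of the curling-number transform

-- The word `axa`, of length p + 1, is both a prefix and a suffix of the overlap, and the two
-- occurrences are p apart.
overlap⇒Agree : ∀ (f : ℕ → A) i a x → let u = a ∷ x ++ a ∷ x ++ a ∷ [] ; p = suc (length x) in
                u ≡ block f i (length u) → Agree f i (p + i) (suc p)
overlap⇒Agree f i a x u≡ = window-injective (begin
  window f i (suc p)             ≡⟨ cong (window f i) length≡ ⟨
  window f i (length axa)        ≡⟨ proj₁ (window-++⁻ (length u) axa (trans (sym window≡)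
                                      (sym (++-assoc (a ∷ x) (a ∷ []) (x ++ a ∷ []))))) ⟨
  axa                            ≡⟨ proj₂ (window-++⁻ (length u) (a ∷ x) (sym window≡)) ⟩
  window f (p + i) (length axa)  ≡⟨ cong (window f (p + i)) length≡ ⟩
  window f (p + i) (suc p)       ∎)
  where
  open ≡-Reasoning
  p = suc (length x)
  u = a ∷ x ++ a ∷ x ++ a ∷ []
  axa = a ∷ x ++ a ∷ []
  window≡ : u ≡ window f i (length u)
  window≡ = trans u≡ (block≡window f i (length u))
  length≡ : length axa ≡ suc p
  length≡ = cong suc (trans (length-++ x) (+-comm (length x) 1))

curlingTransform-overlap-free : OverlapFree (curlingTransform _≟_ w)
curlingTransform-overlap-free u (i , u≡) (a , x , refl) =
  t-no-overlap (length x) (99 + i) (agree λ {j} j<2+x → bit-injective (begin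
    bit (t (j + (99 + i)))         ≡⟨ value j i ⟩
    C (j + i)                      ≡⟨ at (overlap⇒Agree C i a x u≡) j<2+x ⟩
    C (j + (p + i))                ≡⟨ value j (p + i) ⟨
    bit (t (j + (99 + (p + i))))   ≡⟨ cong (λ y → bit (t (j + y))) (x∙yz≈y∙xz 99 p i) ⟩
    bit (t (j + (p + (99 + i))))   ∎))
  where
  open ≡-Reasoning
  C = curlingTransform _≟_ w
  p = suc (length x)
  value : ∀ j i → bit (t (j + (99 + i))) ≡ C (j + i)
  value j i = trans (cong (bit ∘ t) (x∙yz≈y∙xz j 99 i)) (sym (curlingTransform≡bit (j + i)))

theorem8 : Σ[ w ∈ InfWord (Fin 3) ] ((+ 9 / 4) ⁺-Free w) × OverlapFree (curlingTransform _≟_ w)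
theorem8 = w , w-⁺-free , curlingTransform-overlap-free
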